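{- For any graph $\Gamma$, the dimer complex $X_{\mathcal{D}}(\Gamma)$ is a nonpositively curved cubed complex.
   Context: A graph is a nonempty 1-dimensional CW-complex with no loops and no isolated vertices (multiple edges allowed); $E$ is its edge set. The power group $2^E$ is the group of subsets of $E$ under symmetric difference. An even cycle is a finite set of edges forming an embedded circle with an even number of edges; two edge sets are independent if no edge of one shares a vertex with an edge of the other. $\mathcal{D}=\mathcal{D}(\Gamma)$ is the set of perfect matchings (edge sets meeting every vertex in exactly one edge). For a finite set $T$ of pairwise independent even cycles let $[T]=\bigcup_{t\in T}t$ (the product in $2^E$). The dimer complex $X_{\mathcal{D}}$ is the cubed complex with one $k$-cube for each pair $(A,S)$ where $A\in\mathcal{D}$ and $S$ is a set of $k$ pairwise independent even cycles with $[T]A\in\mathcal{D}$ for all $T\subset S$, the pairs $(A,S)$ and $([T]A,S)$ ($T\subset S$) giving the same cube; the vertices of this cube are the perfect matchings $[T]A$, $T\subset S$, and its faces are the cubes of $(A,S')$, $S'\subset S$ (so $A,B\in\mathcal{D}$ are joined by an edge iff $AB$ is an even cycle). A cubed complex is nonpositively curved if the link of each 0-cell is a simplicial complex and is a flag complex. -}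

module Defs where

open import Data.Bool.Base using (Bool; true; false; _∧_; _∨_; _xor_)
open import Data.Bool.Properties using (∧-zeroʳ; ∨-identityʳ; xor-assoc; ¬-not)
open import Data.Empty using (⊥-elim)
open import Data.Fin.Base using (Fin; zero; suc; toℕ)
open import Data.Fin.Patterns using (0F; 1F)
open import Data.Fin.Properties using (_≟_; any?)
open import Data.Nat.Base using (ℕ; zero; suc; NonZero)
open import Data.Nat.Divisibility using (_∣_)
open import Data.Nat.DivMod using (_mod_)
open import Data.Product.Base using (Σ-syntax; ∃-syntax; _×_; _,_; proj₁; proj₂)
open import Data.Product using (∃!)
open import Data.Sum.Base using (_⊎_; inj₁)
open import Data.Vec.Functional using (foldr)
import Data.Bool.Properties as Bool
open import Function.Base using (_∘_; _on_)
open import Function.Bundles using (_↣_; _↔_; _⇔_; Injection; mk↣)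
open import Function.Construct.Composition using (_↣-∘_)
open import Function.Construct.Identity using (↣-id)
open import Function.Definitions using (Injective)
open import Function.Properties.Inverse using (↔⇒↣)
open import Level using (Level; _⊔_; 0ℓ) renaming (suc to lsuc)
open import Relation.Binary.Core using (Rel)
open import Relation.Binary.PropositionalEquality
  using (_≡_; _≢_; _≗_; refl; sym; trans; cong; cong₂)
open import Relation.Binary.Structures using (IsEquivalence)
open import Relation.Nullary.Decidable.Core using (yes; no; does)
open import Relation.Nullary.Negation.Core using (¬_)

private variable
  a c e s v ℓ : Level
  A : Set a
  i j k m n : ℕ

------------------------------------------------------------------------
-- Power groups

-- Subsets are characteristic functions, compared pointwise by _≗_.
2^ : Set a → Set a
2^ A = A → Bool

infix 4 _∈_
_∈_ : A → 2^ A → Set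
x ∈ P = P x ≡ true

∅ : 2^ A
∅ _ = false

-- Symmetric difference: the multiplication of the power group.
infixr 6 _△_
_△_ : 2^ A → 2^ A → 2^ A
(P △ Q) x = P x xor Q x

⋁ : (Fin k → Bool) → Bool
⋁ = foldr _∨_ false

-- The union of the members P i with i ∈ T.
⋃[_] : 2^ (Fin k) → (Fin k → 2^ A) → 2^ A
⋃[ T ] P x = ⋁ λ i → T i ∧ P i x

⁅_⁆ : Fin k → 2^ (Fin k)
⁅ i ⁆ j = does (i ≟ j)

infixr 8 _⟨$⟩_
_⟨$⟩_ : Fin m ↣ Fin n → Fin m → Fin n
_⟨$⟩_ = Injection.to

------------------------------------------------------------------------
-- Cubed complexes

-- An isometry of I^m onto an m-dimensional face of I^n.  Vertices of I^n are
-- identified with subsets of Fin n; the isometry sends the vertex ∅ to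
-- `origin`, and the i-th coordinate direction to the direction `axes ⟨$⟩ i`.
record FaceMap (m n : ℕ) : Set where
  constructor face
  field
    origin : 2^ (Fin n)
    axes   : Fin m ↣ Fin n

  onVertex : 2^ (Fin m) → 2^ (Fin n)
  onVertex x = origin △ ⋃[ x ] (λ i → ⁅ axes ⟨$⟩ i ⁆)

open FaceMap public

infix 4 _≈ᶠ_
_≈ᶠ_ : Rel (FaceMap m n) 0ℓ
φ ≈ᶠ ψ = origin φ ≗ origin ψ × (axes φ ⟨$⟩_) ≗ (axes ψ ⟨$⟩_)

idᶠ : FaceMap n n
idᶠ = face ∅ (↣-id _)

infixr 9 _∘ᶠ_
_∘ᶠ_ : FaceMap j k → FaceMap i j → FaceMap i k
φ ∘ᶠ ψ = face (onVertex φ (origin ψ)) (axes φ ↣-∘ axes ψ)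

-- The face containing the vertex ∅ that is spanned by the given directions.
cornerFace : Fin m ↣ Fin n → FaceMap m n
cornerFace σ = face ∅ σ

noAxes : Fin 0 ↣ Fin n
noAxes = mk↣ {to = λ ()} λ { {()} }

oneAxis : Fin n → Fin 1 ↣ Fin n
oneAxis i = mk↣ {to = λ _ → i} λ { {0F} {0F} _ → refl }

-- A cubed complex is encoded by its parametrized cubes: `Cube n` consists of
-- all maps I^n → X obtained by composing an isometry of I^n with the
-- characteristic map of an n-cell, so the n-cells are the orbits of the
-- symmetries of I^n on `Cube n`.  The cube x ∙ φ is the composite of x with φ.
record RawCubedComplex c ℓ : Set (lsuc (c ⊔ ℓ)) where
  infix  4 _≈_
  infixl 7 _∙_
  field
    Cube : ℕ → Set c
    _≈_  : Rel (Cube n) ℓ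
    _∙_  : Cube n → FaceMap m n → Cube m

  corner : Cube n → Cube 0
  corner x = x ∙ cornerFace noAxes

-- `free` says that a cell is injective on the interior of the cube: no cell is
-- folded onto itself by a nontrivial symmetry of I^n.
record IsCubedComplex (X : RawCubedComplex c ℓ) : Set (c ⊔ ℓ) where
  open RawCubedComplex X
  field
    isEquivalence : IsEquivalence (_≈_ {n})
    ∙-cong        : {x y : Cube n} {φ ψ : FaceMap m n} →
                    x ≈ y → φ ≈ᶠ ψ → x ∙ φ ≈ y ∙ ψ
    ∙-identity    : (x : Cube n) → x ∙ idᶠ ≈ x
    ∙-compose     : (x : Cube k) (φ : FaceMap j k) (ψ : FaceMap i j) →
                    x ∙ (φ ∘ᶠ ψ) ≈ (x ∙ φ) ∙ ψ
    free          : (x : Cube n) (φ : FaceMap n n) → x ∙ φ ≈ x → φ ≈ᶠ idᶠ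

------------------------------------------------------------------------
-- Simplicial and flag complexes

-- Sets of simplices with ordered vertices: `Simplex d` consists of the
-- d-simplices together with an ordering of their vertices, so two elements
-- represent the same simplex iff they differ by a permutation.  The vertices
-- of a simplex need not be distinct, and need not determine the simplex.
record RawSimplices s ℓ : Set (lsuc (s ⊔ ℓ)) where
  infix  4 _≈_ _∼_
  infixl 7 _∙_
  field
    Simplex : ℕ → Set s
    _≈_     : Rel (Simplex n) ℓ
    _∙_     : Simplex n → Fin (suc m) ↣ Fin (suc n) → Simplex m

  vertex : Simplex n → Fin (suc n) → Simplex 0
  vertex x i = x ∙ oneAxis i

  -- x and y represent the same simplex.
  _∼_ : Simplex m → Simplex n → Set ℓ
  _∼_ {m} {n} x y = Σ[ π ∈ Fin (suc m) ↔ Fin (suc n) ] x ≈ y ∙ ↔⇒↣ π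

  _⊆ᵛ_ : Simplex m → Simplex n → Set ℓ
  x ⊆ᵛ y = ∀ i → ∃[ j ] vertex x i ≈ vertex y j

  Adjacent : Simplex 0 → Simplex 0 → Set (s ⊔ ℓ)
  Adjacent p q = Σ[ x ∈ Simplex 1 ] vertex x 0F ≈ p × vertex x 1F ≈ q

record IsSimplicialComplex (K : RawSimplices s ℓ) : Set (s ⊔ ℓ) where
  open RawSimplices K
  field
    isEquivalence         : IsEquivalence (_≈_ {n})
    ∙-cong                : {x y : Simplex n} {σ τ : Fin (suc m) ↣ Fin (suc n)} →
                            x ≈ y → (σ ⟨$⟩_) ≗ (τ ⟨$⟩_) → x ∙ σ ≈ y ∙ τ
    ∙-identity            : (x : Simplex n) → x ∙ ↣-id _ ≈ x
    ∙-compose             : (x : Simplex k) (σ : Fin (suc j) ↣ Fin (suc k))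
                            (τ : Fin (suc i) ↣ Fin (suc j)) →
                            x ∙ (σ ↣-∘ τ) ≈ (x ∙ σ) ∙ τ
    vertices-distinct     : (x : Simplex n) → Injective _≡_ _≈_ (vertex x)
    determinedByVertices  : (x : Simplex m) (y : Simplex n) →
                            x ⊆ᵛ y → y ⊆ᵛ x → x ∼ y

record IsFlagComplex (K : RawSimplices s ℓ) : Set (s ⊔ ℓ) where
  open RawSimplices K
  field
    isSimplicialComplex : IsSimplicialComplex K
    spans               : (p : Fin (suc n) → Simplex 0) →
                          (∀ {i j} → i ≢ j → Adjacent (p i) (p j)) →
                          Σ[ x ∈ Simplex n ] (∀ i → vertex x i ≈ p i)

------------------------------------------------------------------------
-- Links and nonpositive curvature

⋁-false : (f : Fin k → Bool) → (∀ i → f i ≡ false) → ⋁ f ≡ false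
⋁-false {zero}  f h = refl
⋁-false {suc k} f h rewrite h zero = ⋁-false (f ∘ suc) (h ∘ suc)

-- A (k-1)-simplex of the link of P is given by a k-cell together with a vertex
-- of I^k carried to P.  Applying a symmetry of I^k one may take this vertex to
-- be ∅, and ordering the vertices of the simplex then amounts to ordering the
-- k directions at ∅.
module _ {X : RawCubedComplex c ℓ} (isCubedComplex : IsCubedComplex X) where
  open RawCubedComplex X
  open IsCubedComplex isCubedComplex

  corner-∙ : (x : Cube n) (σ : Fin m ↣ Fin n) →
             corner (x ∙ cornerFace σ) ≈ corner x
  corner-∙ {n} x σ = E.trans (E.sym (∙-compose x (cornerFace σ) (cornerFace noAxes)))
    (∙-cong E.refl ((λ l → ⋁-false {_} (λ i → false ∧ ⁅ σ ⟨$⟩ i ⁆ l) (λ _ → refl)) , λ ()))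
    where module E {n} = IsEquivalence (isEquivalence {n})

  link : Cube 0 → RawSimplices (c ⊔ ℓ) ℓ
  link P = record
    { Simplex = λ d → Σ[ x ∈ Cube (suc d) ] corner x ≈ P
    ; _≈_     = _≈_ on proj₁
    ; _∙_     = λ { (x , x≈P) σ →
                    x ∙ cornerFace σ , IsEquivalence.trans isEquivalence (corner-∙ x σ) x≈P }
    }

record IsNonpositivelyCurvedCubedComplex (X : RawCubedComplex c ℓ) : Set (c ⊔ ℓ) where
  field
    isCubedComplex : IsCubedComplex X
    link-isFlag    : (P : RawCubedComplex.Cube X 0) → IsFlagComplex (link isCubedComplex P)

------------------------------------------------------------------------
-- Graphs, perfect matchings and even cycles

-- The orientation of edges by `source` and `target` is arbitrary and plays no
-- role in any of the notions below.
record Graph v e : Set (lsuc (v ⊔ e)) where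
  field
    Vertex        : Set v
    Edge          : Set e
    source target : Edge → Vertex

  Incident : Edge → Vertex → Set v
  Incident f x = source f ≡ x ⊎ target f ≡ x

  Joins : Edge → Vertex → Vertex → Set v
  Joins f x y = (source f ≡ x × target f ≡ y) ⊎ (source f ≡ y × target f ≡ x)

  field
    nonempty   : Vertex
    noLoops    : ∀ f → source f ≢ target f
    noIsolated : ∀ x → ∃[ f ] Incident f x

module _ (Γ : Graph v e) where
  open Graph Γ

  IsPerfectMatching : 2^ Edge → Set (v ⊔ e)
  IsPerfectMatching M = ∀ x → ∃! _≡_ (λ f → f ∈ M × Incident f x)

  -- The edges `edge i` run from `corner i` to `corner (i + 1)`, indices being
  -- read modulo `size`.  In size 2 these are two parallel edges.
  record IsEvenCycle (C : 2^ Edge) : Set (v ⊔ e) where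
    field
      size             : ℕ
      ⦃ size≢0 ⦄       : NonZero size
      even             : 2 ∣ size
      corner           : Fin size → Vertex
      edge             : Fin size → Edge
      corner-injective : Injective _≡_ _≡_ corner
      edge-injective   : Injective _≡_ _≡_ edge
      joins            : ∀ i → Joins (edge i) (corner i) (corner (suc (toℕ i) mod size))
      edges            : ∀ f → f ∈ C ⇔ (∃[ i ] edge i ≡ f)

  Independent : 2^ Edge → 2^ Edge → Set (v ⊔ e)
  Independent C D = ∀ {f g} → f ∈ C → g ∈ D → ∀ x → ¬ (Incident f x × Incident g x)

  -- The pair (A, S), with the cycles of S listed in some order.  They are
  -- automatically distinct, since an even cycle is not independent of itself.
  record BasedCube (k : ℕ) : Set (v ⊔ e) where
    field
      base        : 2^ Edge
      matching    : IsPerfectMatching base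
      cycle       : Fin k → 2^ Edge
      evenCycle   : ∀ i → IsEvenCycle (cycle i)
      independent : ∀ {i j} → i ≢ j → Independent (cycle i) (cycle j)
      flips       : (T : 2^ (Fin k)) → IsPerfectMatching (⋃[ T ] cycle △ base)

  open BasedCube

  ⋁-single : (f g : Fin k → Bool) (l : Fin k) → (∀ i → g i ≡ does (i ≟ l)) →
             ⋁ (λ i → f i ∧ g i) ≡ f l
  ⋁-single f g zero h
    rewrite h zero
          | ⋁-false (λ i → f (suc i) ∧ g (suc i))
              (λ i → trans (cong (f (suc i) ∧_) (h (suc i))) (∧-zeroʳ (f (suc i))))
          | ∨-identityʳ (f zero ∧ true) = Bool.∧-identityʳ (f zero)
  ⋁-single f g (suc l) h
    rewrite h zero | ∧-zeroʳ (f zero) = ⋁-single (f ∘ suc) (g ∘ suc) l (h ∘ suc)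

  ⋁-cong : {f g : Fin k → Bool} → f ≗ g → ⋁ f ≡ ⋁ g
  ⋁-cong {zero}  h = refl
  ⋁-cong {suc k} h = cong₂ _∨_ (h zero) (⋁-cong (h ∘ suc))

  ∈-single : (x : BasedCube k) {f : Edge} {l : Fin k} → f ∈ cycle x l →
             ∀ i → cycle x i f ≡ does (i ≟ l)
  ∈-single x {f} {l} f∈l i with i ≟ l
  ... | yes refl = f∈l
  ... | no i≢l   = ¬-not λ f∈i →
    independent x i≢l f∈i f∈l (source f) (inj₁ refl , inj₁ refl)

  ⋃-onVertex : (x : BasedCube n) (φ : FaceMap m n) (T : 2^ (Fin m)) →
    ⋃[ onVertex φ T ] (cycle x) ≗
    ⋃[ T ] (λ i → cycle x (axes φ ⟨$⟩ i)) △ ⋃[ origin φ ] (cycle x)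
  ⋃-onVertex x φ T f with any? (λ l → cycle x l f Bool.≟ true)
  ... | yes (l , f∈l) = trans (⋁-single (onVertex φ T) (λ i → cycle x i f) l (∈-single x f∈l))
    (trans (Bool.xor-comm (origin φ l) _)
      (sym (cong₂ _xor_
        (⋁-cong λ i → cong (T i ∧_) (∈-single x f∈l (axes φ ⟨$⟩ i)))
        (⋁-single (origin φ) (λ i → cycle x i f) l (∈-single x f∈l)))))
  ... | no none = trans (vanish _ none′)
    (sym (cong₂ _xor_ (vanish T (none′ ∘ (axes φ ⟨$⟩_))) (vanish (origin φ) none′)))
    where
    none′ : ∀ i → cycle x i f ≡ false
    none′ i = ¬-not λ f∈i → none (i , f∈i)
    vanish : (U : 2^ (Fin k)) {g : Fin k → Bool} → (∀ i → g i ≡ false) →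
             ⋁ (λ i → U i ∧ g i) ≡ false
    vanish U h = ⋁-false _ λ i → trans (cong (U i ∧_) (h i)) (∧-zeroʳ (U i))

  matching-resp : {M N : 2^ Edge} → M ≗ N → IsPerfectMatching M → IsPerfectMatching N
  matching-resp M≗N pm x with pm x
  ... | f , (f∈M , fx) , unique =
    f , (trans (sym (M≗N f)) f∈M , fx) ,
    λ { {g} (g∈N , gx) → unique (trans (M≗N g) g∈N , gx) }

  -- Cells are orbits under symmetries of I^k, which act by permuting the
  -- cycles and by replacing (A, S) with ([T]A, S).
  dimerComplex : RawCubedComplex (v ⊔ e) e
  dimerComplex = record
    { Cube = BasedCube
    ; _≈_  = λ x y → base x ≗ base y × (∀ i → cycle x i ≗ cycle y i)
    ; _∙_  = λ x φ → record
      { base        = ⋃[ origin φ ] (cycle x) △ base x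
      ; matching    = flips x (origin φ)
      ; cycle       = λ i → cycle x (axes φ ⟨$⟩ i)
      ; evenCycle   = λ i → evenCycle x (axes φ ⟨$⟩ i)
      ; independent = λ i≢j → independent x (i≢j ∘ Injection.injective (axes φ))
      ; flips       = λ T → matching-resp
          (λ f → trans (cong (_xor base x f) (⋃-onVertex x φ T f))
                       (xor-assoc (⋃[ T ] (λ i → cycle x (axes φ ⟨$⟩ i)) f) _ _))
          (flips x (onVertex φ T))
      }
    }

{-# OPTIONS --safe #-}
module Submission where

open import Defs
open import Data.Bool.Base using (Bool; true; false; _∧_; _∨_; _xor_)
open import Data.Bool.Properties using (∧-conicalˡ; ∧-conicalʳ; ∨-zeroʳ; ∨-identityʳ; xor-assoc; not-¬)
open import Data.Fin.Base using (Fin; zero; suc; fromℕ<)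
open import Data.Fin.Patterns using (0F; 1F)
open import Data.Fin.Properties using (_≟_)
open import Data.Nat.Base using (ℕ; suc; >-nonZero⁻¹)
open import Data.Product.Base using (∃-syntax; _×_; _,_; proj₁; proj₂)
open import Data.Sum.Base using (_⊎_; inj₁; inj₂)
open import Function.Base using (_∘_)
open import Function.Bundles using (Equivalence; mk↔ₛ′)
open import Level using (Level)
open import Relation.Binary.PropositionalEquality
  using (_≡_; _≢_; _≗_; refl; sym; trans; cong; cong₂; subst)
open import Relation.Binary.Structures using (IsEquivalence)
open import Relation.Nullary.Decidable.Core using (yes; no)
open import Relation.Nullary.Negation.Core using (contradiction)

-- Every edge set in sight is decidable, so the unique edge of a flipped
-- matching at a vertex x can be read off from the edge f of the original
-- matching at x: if f lies in a flipped cycle, that cycle alone decides the new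
-- edge, and otherwise f survives.  Hence pairwise independent flips are jointly
-- flippable, which is flagness of links.  A cube at a given vertex is determined
-- by its cycles, and independent cycles are distinct because they are nonempty.

private variable
  a v e : Level
  A : Set a
  k m n : ℕ

true≢false : {b : Bool} → b ≡ true → b ≢ false
true≢false refl ()

xor-identity⇒false : ∀ p {q} → p xor q ≡ q → p ≡ false
xor-identity⇒false false _  = refl
xor-identity⇒false true  eq = contradiction (sym eq) (not-¬ refl)

⋁⁺ : (f : Fin k → Bool) (i : Fin k) → f i ≡ true → ⋁ f ≡ true
⋁⁺ f zero    fi = cong (_∨ ⋁ (f ∘ suc)) fi
⋁⁺ f (suc i) fi = trans (cong (f zero ∨_) (⋁⁺ (f ∘ suc) i fi)) (∨-zeroʳ (f zero))

⋁⁻ : (f : Fin k → Bool) → ⋁ f ≡ true → ∃[ i ] f i ≡ true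
⋁⁻ {suc k} f ⋁f with f zero in f0
... | true  = zero , f0
... | false with ⋁⁻ (f ∘ suc) ⋁f
...   | i , fi = suc i , fi

∈⋃⁺ : {T : 2^ (Fin k)} {P : Fin k → 2^ A} {x : A} {i : Fin k} →
      i ∈ T → x ∈ P i → x ∈ ⋃[ T ] P
∈⋃⁺ {i = i} i∈T x∈Pi = ⋁⁺ _ i (cong₂ _∧_ i∈T x∈Pi)

∈⋃⁻ : {T : 2^ (Fin k)} {P : Fin k → 2^ A} {x : A} →
      x ∈ ⋃[ T ] P → ∃[ i ] i ∈ T × x ∈ P i
∈⋃⁻ x∈⋃ with ⋁⁻ _ x∈⋃
... | i , both = i , ∧-conicalˡ _ _ both , ∧-conicalʳ _ _ both

⋃-∅ : (P : Fin k → 2^ A) → ⋃[ ∅ ] P ≗ ∅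
⋃-∅ P x = ⋁-false (λ i → false ∧ P i x) (λ _ → refl)

∈△⁻ : (P Q : 2^ A) {x : A} → x ∈ P △ Q → (x ∈ P × Q x ≡ false) ⊎ (P x ≡ false × x ∈ Q)
∈△⁻ P Q {x} x∈ with P x | Q x
... | true  | false = inj₁ (refl , refl)
... | false | true  = inj₂ (refl , refl)

∈△ˡ : (P Q : 2^ A) {x : A} → x ∈ P → Q x ≡ false → x ∈ P △ Q
∈△ˡ _ _ x∈P x∉Q = cong₂ _xor_ x∈P x∉Q

∈△ʳ : (P Q : 2^ A) {x : A} → P x ≡ false → x ∈ Q → x ∈ P △ Q
∈△ʳ _ _ x∉P x∈Q = cong₂ _xor_ x∉P x∈Q

module _ (Γ : Graph v e) where
  open Graph Γ
  open BasedCube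
  open RawCubedComplex (dimerComplex Γ) using (_≈_; corner)

  evenCycle-nonempty : {C : 2^ Edge} → IsEvenCycle Γ C → ∃[ f ] f ∈ C
  evenCycle-nonempty c = edge i , Equivalence.from (edges (edge i)) (i , refl)
    where
    open IsEvenCycle c
    i : Fin size
    i = fromℕ< (>-nonZero⁻¹ size)

  -- An edge common to the cycles at `i` and `j` would violate independence unless `i ≡ j`. This
  -- lets directions of a cube be recovered from their cycles, both for freeness and in links.
  cycle-injective : (x : BasedCube Γ k) {i j : Fin k} → cycle x i ≗ cycle x j → i ≡ j
  cycle-injective x {i} {j} i≗j with evenCycle-nonempty (evenCycle x i)
  ... | f , f∈i with i ≟ j | ∈-single Γ x (trans (sym (i≗j f)) f∈i) i
  ...   | yes i≡j | _ = i≡j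
  ...   | no _    | f∉i = contradiction f∉i (true≢false f∈i)

  ⋃-cong : {T U : 2^ (Fin k)} {P Q : Fin k → 2^ A} →
           T ≗ U → (∀ i → P i ≗ Q i) → ⋃[ T ] P ≗ ⋃[ U ] Q
  ⋃-cong T≗U P≗Q x = ⋁-cong Γ λ i → cong₂ _∧_ (T≗U i) (P≗Q i x)

  -- Each vertex is compared directly with a single flip there, with no induction on `T`: the
  -- hypothesis `flip` concerns `M` itself, not an already flipped matching.
  ⋃-flip-matching :
    {M : 2^ Edge} {C : Fin k → 2^ Edge} → IsPerfectMatching Γ M →
    (∀ {i j} → i ≢ j → Independent Γ (C i) (C j)) →
    (∀ i → IsPerfectMatching Γ (C i △ M)) →
    (T : 2^ (Fin k)) → IsPerfectMatching Γ (⋃[ T ] C △ M)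
  ⋃-flip-matching {M = M} {C} pm indep flip T x with pm x
  ... | f , (f∈M , fx) , f-unique with (⋃[ T ] C) f in f∈?⋃
  ...   | false = f , (∈△ʳ (⋃[ T ] C) M f∈?⋃ f∈M , fx) , unique
    where
    f∉C : ∀ {i} → i ∈ T → C i f ≡ false
    f∉C {i} i∈T with C i f in f∈?Ci
    ... | false = refl
    ... | true  = contradiction f∈?⋃ (true≢false (∈⋃⁺ {T = T} {C} i∈T f∈?Ci))
    unique : ∀ {g} → g ∈ ⋃[ T ] C △ M × Incident g x → f ≡ g
    unique (g∈ , gx) with ∈△⁻ (⋃[ T ] C) M g∈
    ... | inj₂ (_ , g∈M) = f-unique (g∈M , gx)
    ... | inj₁ (g∈⋃ , g∉M) with ∈⋃⁻ {T = T} {C} g∈⋃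
    ...   | i , i∈T , g∈Ci with flip i x
    ...     | _ , _ , h-unique =
      -- Both `f`, which survives the flip of `C i`, and `g`, which it adds, lie in `C i △ M` and
      -- meet `x`.
      trans (sym (h-unique (∈△ʳ (C i) M (f∉C i∈T) f∈M , fx)))
            (h-unique (∈△ˡ (C i) M g∈Ci g∉M , gx))
  ...   | true with ∈⋃⁻ {T = T} {C} f∈?⋃
  ...     | i , i∈T , f∈Ci with flip i x
  ...       | h , (h∈ , hx) , h-unique with ∈△⁻ (C i) M h∈
  -- Here `h` would be the edge of `M` at `x`, namely `f`, which the flip of `C i` removes.
  ...         | inj₂ (h∉Ci , h∈M) =
    contradiction h∉Ci (true≢false (subst (_∈ C i) (f-unique (h∈M , hx)) f∈Ci))
  ...         | inj₁ (h∈Ci , h∉M) =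
    h , (∈△ˡ (⋃[ T ] C) M (∈⋃⁺ {T = T} {C} i∈T h∈Ci) h∉M , hx) , unique
    where
    unique : ∀ {g} → g ∈ ⋃[ T ] C △ M × Incident g x → h ≡ g
    unique (g∈ , gx) with ∈△⁻ (⋃[ T ] C) M g∈
    ... | inj₂ (g∉⋃ , g∈M) =
      contradiction g∉⋃ (true≢false (subst (_∈ ⋃[ T ] C) (f-unique (g∈M , gx)) f∈?⋃))
    ... | inj₁ (g∈⋃ , g∉M) with ∈⋃⁻ {T = T} {C} g∈⋃
    ...   | j , _ , g∈Cj with i ≟ j
    ...     | yes refl = h-unique (∈△ˡ (C i) M g∈Cj g∉M , gx)
    -- The removed edge `f` of `C i` and the edge `g` of `C j` would meet at `x`.
    ...     | no i≢j   = contradiction (fx , gx) (indep i≢j f∈Ci g∈Cj x)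

  dimerComplex-isCubedComplex : IsCubedComplex (dimerComplex Γ)
  dimerComplex-isCubedComplex = record
    { isEquivalence = record
      { refl  = (λ _ → refl) , λ _ _ → refl
      ; sym   = λ (b , c) → (λ f → sym (b f)) , λ i f → sym (c i f)
      ; trans = λ (b , c) (b′ , c′) →
                (λ f → trans (b f) (b′ f)) , λ i f → trans (c i f) (c′ i f)
      }
    ; ∙-cong = λ {x = x} {φ = φ} {ψ} (b , c) (o , α) →
        (λ f → cong₂ _xor_ (⋃-cong o c f) (b f)) ,
        λ i f → trans (cong (λ j → cycle x j f) (α i)) (c (axes ψ ⟨$⟩ i) f)
    ; ∙-identity = λ x →
        (λ f → cong (_xor base x f) (⋃-∅ (cycle x) f)) , λ _ _ → refl
    ; ∙-compose = λ x φ ψ →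
        (λ f → trans (cong (_xor base x f) (⋃-onVertex Γ x φ (origin ψ) f))
                     (xor-assoc ((⋃[ origin ψ ] (λ i → cycle x (axes φ ⟨$⟩ i))) f) _ _)) ,
        λ _ _ → refl
    ; free = λ x φ (b , c) → origin-∅ x φ b , λ i → cycle-injective x (c i)
    }
    where
    -- An edge of the cycle at `l` lies in no other cycle of `x`, so it is flipped exactly when
    -- `l ∈ origin φ`; an unchanged base excludes this.
    origin-∅ : (x : BasedCube Γ n) (φ : FaceMap n n) →
               ⋃[ origin φ ] (cycle x) △ base x ≗ base x → origin φ ≗ ∅
    origin-∅ x φ b l with evenCycle-nonempty (evenCycle x l)
    ... | f , f∈l = trans
      (sym (⋁-single Γ (origin φ) (λ i → cycle x i f) l (∈-single Γ x f∈l)))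
      (xor-identity⇒false ((⋃[ origin φ ] (cycle x)) f) (b f))

  -- The corner flips the empty set of cycles, so a simplex of the link of `P` is a cube based at
  -- `P` and is known from its cycles alone.
  corner≈⇒base : {x : BasedCube Γ n} {P : BasedCube Γ 0} → corner x ≈ P → base x ≗ base P
  corner≈⇒base {x = x} x≈P f =
    trans (cong (_xor base x f) (sym (⋃-∅ (cycle x) f))) (proj₁ x≈P f)

  module _ (P : BasedCube Γ 0) where
    open RawSimplices (link dimerComplex-isCubedComplex P)
      using (Simplex; vertex; Adjacent; _⊆ᵛ_; _∼_)

    -- The vertices of a simplex are the cycles of its cube. The two inclusions give index maps that
    -- preserve cycles, hence are mutually inverse by `cycle-injective`.
    ⊆ᵛ-antisym : (x : Simplex m) (y : Simplex n) → x ⊆ᵛ y → y ⊆ᵛ x → x ∼ y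
    ⊆ᵛ-antisym (x , x≈P) (y , y≈P) x⊆y y⊆x =
      mk↔ₛ′ to from
        (λ j → cycle-injective y λ f → sym (trans (from-cycle j f) (to-cycle (from j) f)))
        (λ i → cycle-injective x λ f → sym (trans (to-cycle i f) (from-cycle (to i) f))) ,
      (λ f → trans (corner≈⇒base {x = x} {P} x≈P f)
        (trans (sym (corner≈⇒base {x = y} {P} y≈P f))
          (sym (cong (_xor base y f) (⋃-∅ (cycle y) f))))) ,
      to-cycle
      where
      to = λ i → proj₁ (x⊆y i)
      from = λ j → proj₁ (y⊆x j)
      to-cycle : ∀ i → cycle x i ≗ cycle y (to i)
      to-cycle i = proj₂ (proj₂ (x⊆y i)) 0F
      from-cycle : ∀ j → cycle y j ≗ cycle x (from j)
      from-cycle j = proj₂ (proj₂ (y⊆x j)) 0F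

    -- Each `p i` is a single cycle flippable at `P`. The squares given by adjacency supply pairwise
    -- independence, and `⋃-flip-matching` supplies the joint flips.
    spannedSimplex : (p : Fin (suc n) → Simplex 0) →
                     (∀ {i j} → i ≢ j → Adjacent (p i) (p j)) →
                     ∃[ x ] (∀ i → proj₁ (vertex {n} x i) ≈ proj₁ (p i))
    spannedSimplex {n} p adjacent =
      (cube , (λ f → cong (_xor base P f) (⋃-∅ C f)) , λ ()) ,
      λ i → (λ f → trans (cong (_xor base P f) (⋃-∅ C f)) (sym (base-p i f))) ,
            λ { 0F _ → refl }
      where
      C : Fin (suc n) → 2^ Edge
      C i = cycle (proj₁ (p i)) 0F
      base-p : ∀ i → base (proj₁ (p i)) ≗ base P
      base-p i = corner≈⇒base {x = proj₁ (p i)} {P} (proj₂ (p i))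
      independent-C : ∀ {i j} → i ≢ j → Independent Γ (C i) (C j)
      independent-C i≢j {f} {g} f∈ g∈ with adjacent i≢j
      ... | (x , _) , x0≈ , x1≈ =
        independent x {0F} {1F} (λ ()) (trans (proj₂ x0≈ 0F f) f∈) (trans (proj₂ x1≈ 0F g) g∈)
      cube : BasedCube Γ (suc n)
      cube = record
        { base        = base P
        ; matching    = matching P
        ; cycle       = C
        ; evenCycle   = λ i → evenCycle (proj₁ (p i)) 0F
        ; independent = independent-C
        ; flips       = ⋃-flip-matching (matching P) independent-C λ i →
            matching-resp Γ
              -- Flipping the full index set of the 1-cube `p i` gives the union `C i f ∨ false`.
              (λ f → cong₂ _xor_ (∨-identityʳ (C i f)) (base-p i f))
              (flips (proj₁ (p i)) (λ _ → true))
        }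

theorem6p3 : ∀ {v e} (Γ : Graph v e) → IsNonpositivelyCurvedCubedComplex (dimerComplex Γ)
theorem6p3 Γ = record
  { isCubedComplex = dimerComplex-isCubedComplex Γ
  ; link-isFlag    = λ P → record
    { isSimplicialComplex = record
      { isEquivalence        = record
        { refl  = λ {x} → ≈.refl {x = proj₁ x}
        ; sym   = λ {x} {y} → ≈.sym {x = proj₁ x} {proj₁ y}
        ; trans = λ {x} {y} {z} → ≈.trans {i = proj₁ x} {proj₁ y} {proj₁ z}
        }
      ; ∙-cong               = λ {x = x} {y} {σ} {τ} x≈y σ≗τ →
          ∙-cong {x = proj₁ x} {proj₁ y} {cornerFace σ} {cornerFace τ}
            x≈y ((λ _ → refl) , σ≗τ)
      ; ∙-identity           = λ x → ∙-identity (proj₁ x)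
      -- The composite of two corner faces has origin only pointwise equal to `∅`, so the empty
      -- unions are removed on both sides instead.
      ; ∙-compose            = λ (x , _) σ τ →
          (λ f → trans (cong (_xor base x f) (⋃-∅ (cycle x) f))
            (sym (cong₂ _xor_ (⋃-∅ (λ i → cycle x (σ ⟨$⟩ i)) f)
                              (cong (_xor base x f) (⋃-∅ (cycle x) f))))) ,
          λ _ _ → refl
      ; vertices-distinct    = λ (x , _) xi≈xj → cycle-injective Γ x (proj₂ xi≈xj 0F)
      ; determinedByVertices = ⊆ᵛ-antisym Γ P
      }
    ; spans = spannedSimplex Γ P
    }
  }
  where
  open IsCubedComplex (dimerComplex-isCubedComplex Γ)
  open BasedCube
  module ≈ {n} = IsEquivalence (isEquivalence {n})
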